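{- There exists a $2$-connected Eulerian loopless odd-$K_5$-minor-free graph $G$ with an even number of edges which is not even-cycle decomposable; that is, $E(G)$ cannot be partitioned into (the edge sets of) cycles of even length.
   Context: Graphs are finite and may have parallel edges (a pair of parallel edges forms a cycle of length $2$). A graph is Eulerian if all its vertices have even degree (connectivity here follows from $2$-connectedness). A signed graph is a pair $(G,\Sigma)$ where $G$ is a graph and $\Sigma\subseteq E(G)$; edges in $\Sigma$ are negative, the other edges are positive. For $X\subseteq V(G)$, $\delta_G(X)$ denotes the set of edges with exactly one end in $X$, and is called a cut. Re-signing $(G,\Sigma)$ means replacing $\Sigma$ by a signature $\Sigma'$ such that the symmetric difference of $\Sigma$ and $\Sigma'$ is a cut of $G$. A minor of a signed graph is a signed graph obtained from it by any sequence of the following operations: re-signing, deleting edges or vertices, and contracting positive edges. For a graph $H$, odd-$H$ is the signed graph $(H,E(H))$. A signed graph is odd-$H$-minor-free if it has no minor isomorphic to odd-$H$. A graph $G$ is odd-$H$-minor-free if the signed graph $(G,E(G))$ is odd-$H$-minor-free. -}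

module Defs where

open import Data.Bool using (_xor_)
open import Data.Fin using (Fin; toℕ; punchIn; _≟_; _<?_)
open import Data.Fin.Subset using (Subset; _∈_; _∉_; _∪_; _─_; ∁; ∣_∣; ⊤)
open import Data.List as List using (List; []; _∷_; allFin; cartesianProduct)
open import Data.Nat as ℕ using (ℕ; suc; NonZero)
open import Data.Nat.Divisibility using (_∣_)
open import Data.Nat.DivMod using (_mod_)
open import Data.Product using (∃; ∃-syntax; ∃!; Σ-syntax; _×_; _,_; proj₁; proj₂; uncurry)
open import Data.Product as Prod using ()
open import Data.Sum using (_⊎_)
open import Data.Vec using (lookup; tabulate)
open import Function.Base using (_∘_)
open import Function.Bundles using (_⇔_; _↔_; Inverse)
open import Function.Definitions using (Injective; Surjective)
open import Relation.Binary.Construct.Closure.ReflexiveTransitive using (Star)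
open import Relation.Binary.PropositionalEquality using (_≡_; _≢_)
open import Relation.Nullary using (¬_)

------------------------------------------------------------------------
-- Graphs

-- A finite multigraph with vertex set Fin n and edge set Fin m. Loops are
-- allowed (contraction may create them), and the order of the two ends of
-- an edge carries no meaning.
record Graph (n m : ℕ) : Set where
  constructor mkGraph
  field
    ends : Fin m → Fin n × Fin n

open Graph public

module _ {n m : ℕ} (G : Graph n m) where

  Joins : Fin m → Fin n → Fin n → Set
  Joins e u v = ends G e ≡ (u , v) ⊎ ends G e ≡ (v , u)

  Incident : Fin n → Fin m → Set
  Incident v e = ∃[ u ] Joins e u v

  Loopless : Set
  Loopless = ∀ e → proj₁ (ends G e) ≢ proj₂ (ends G e)

  endsList : List (Fin n)
  endsList = List.concatMap (λ e → proj₁ (ends G e) ∷ proj₂ (ends G e) ∷ []) (allFin m)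

  -- A loop contributes two to the degree of its vertex.
  degree : Fin n → ℕ
  degree v = List.length (List.filter (_≟ v) endsList)

  Eulerian : Set
  Eulerian = ∀ v → 2 ∣ degree v

  -- The subgraph induced by X is connected (vacuously so if X is empty).
  ConnectedOn : Subset n → Set
  ConnectedOn X = ∀ {u v} → u ∈ X → v ∈ X →
    Star (λ x y → x ∈ X × y ∈ X × ∃[ e ] Joins e x y) u v

  δ : Subset n → Subset m
  δ X = tabulate (λ e → lookup X (proj₁ (ends G e)) xor lookup X (proj₂ (ends G e)))

-- More than k vertices, and deleting fewer than k of them never
-- disconnects the graph.
_is_-connected : ∀ {n m} → Graph n m → ℕ → Set
_is_-connected {n} G k = k ℕ.< n × (∀ X → ∣ X ∣ ℕ.< k → ConnectedOn G (∁ X))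

------------------------------------------------------------------------
-- Cycles

cyclicSuc : ∀ {k} .{{_ : NonZero k}} → Fin k → Fin k
cyclicSuc {k} i = suc (toℕ i) mod k

-- Distinct vertices v₀, …, vₖ₋₁ and distinct edges e₀, …, eₖ₋₁ with eᵢ
-- joining vᵢ and vᵢ₊₁ (indices modulo k). For k = 1 this is a loop, and for
-- k = 2 a pair of parallel edges.
record Cycle {n m} (G : Graph n m) : Set where
  field
    len              : ℕ
    {{len-nonZero}}  : NonZero len
    vertex           : Fin len → Fin n
    edge             : Fin len → Fin m
    vertex-injective : Injective _≡_ _≡_ vertex
    edge-injective   : Injective _≡_ _≡_ edge
    joins            : ∀ i → Joins G (edge i) (vertex i) (vertex (cyclicSuc i))

open Cycle public

EvenCycleDecomposable : ∀ {n m} → Graph n m → Set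
EvenCycleDecomposable G =
  ∃[ k ] Σ[ C ∈ (Fin k → Cycle G) ]
    (∀ i → 2 ∣ len (C i)) ×
    (∀ e → ∃! _≡_ (λ i → ∃[ j ] edge (C i) j ≡ e))

------------------------------------------------------------------------
-- Signed graphs

-- The signature is the set of negative edges.
record SignedGraph : Set where
  constructor ⟨_,_⟩
  field
    {#V #E}   : ℕ
    graph     : Graph #V #E
    signature : Subset #E

open SignedGraph public

odd : ∀ {n m} → Graph n m → SignedGraph
odd G = ⟨ G , ⊤ ⟩

infix 6 _△_

_△_ : ∀ {m} → Subset m → Subset m → Subset m
N △ N′ = (N ─ N′) ∪ (N′ ─ N)

-- The preimage of N under a map of edges.
restrict : ∀ {m m′} → (Fin m′ → Fin m) → Subset m → Subset m′
restrict ι N = tabulate (lookup N ∘ ι)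

-- A single minor operation. Since vertex and edge sets are initial segments,
-- operations that change them relabel what remains:
--  * after deleting the vertex v, the surviving vertices are numbered by
--    punchIn v, and the surviving edges, exactly those not incident with v,
--    by an arbitrary injection ι;
--  * after contracting e, the vertices are numbered by a surjection π that
--    identifies the two ends of e and nothing else. Contracting a loop
--    therefore just removes it.
infix 4 _⟶_ _≅_

data _⟶_ : SignedGraph → SignedGraph → Set where

  resign : ∀ {n m} {G : Graph n m} {N N′ : Subset m} (X : Subset n) →
    N △ N′ ≡ δ G X →
    ⟨ G , N ⟩ ⟶ ⟨ G , N′ ⟩

  deleteEdge : ∀ {n m} {G : Graph n (suc m)} {N} (e : Fin (suc m)) →
    ⟨ G , N ⟩ ⟶ ⟨ mkGraph (ends G ∘ punchIn e) , restrict (punchIn e) N ⟩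

  deleteVertex : ∀ {n m m′} {G : Graph (suc n) m} {G′ : Graph n m′} {N}
    (v : Fin (suc n)) (ι : Fin m′ → Fin m) →
    Injective _≡_ _≡_ ι →
    (∀ e → (¬ Incident G v e) ⇔ (∃[ e′ ] ι e′ ≡ e)) →
    (∀ e′ → ends G (ι e′) ≡ Prod.map (punchIn v) (punchIn v) (ends G′ e′)) →
    ⟨ G , N ⟩ ⟶ ⟨ G′ , restrict ι N ⟩

  contract : ∀ {n n′ m} {G : Graph n (suc m)} {N} (e : Fin (suc m)) →
    e ∉ N →
    (π : Fin n → Fin n′) →
    Surjective _≡_ _≡_ π →
    (∀ x y → (π x ≡ π y) ⇔ (x ≡ y ⊎ Joins G e x y)) →
    ⟨ G , N ⟩ ⟶ ⟨ mkGraph (Prod.map π π ∘ ends G ∘ punchIn e) , restrict (punchIn e) N ⟩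

record _≅_ (S T : SignedGraph) : Set where
  field
    onV : Fin (#V S) ↔ Fin (#V T)
    onE : Fin (#E S) ↔ Fin (#E T)

  open Inverse onV using () renaming (to to f)
  open Inverse onE using () renaming (to to g)

  field
    onEnds      : ∀ e → uncurry (Joins (graph T) (g e)) (Prod.map f f (ends (graph S) e))
    onSignature : ∀ e → (e ∈ signature S) ⇔ (g e ∈ signature T)

HasMinor : SignedGraph → SignedGraph → Set
HasMinor S T = ∃[ S′ ] Star _⟶_ S S′ × S′ ≅ T

OddMinorFree : ∀ {p q n m} → Graph p q → Graph n m → Set
OddMinorFree H G = ¬ HasMinor (odd G) (odd H)

------------------------------------------------------------------------
-- Complete graphs

increasingPairs : ∀ n → List (Fin n × Fin n)
increasingPairs n = List.filter (uncurry _<?_) (cartesianProduct (allFin n) (allFin n))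

K : ∀ n → Graph n (List.length (increasingPairs n))
K n = mkGraph (List.lookup (increasingPairs n))

{-# OPTIONS --safe #-}
module Submission where

-- The counterexample is the Petersen graph, seen as an outer and an inner
-- pentagon joined by five spokes, with one inner edge subdivided and with a
-- triangle in place of every spoke (a path of length two parallel to it).
--
-- An even cycle is not one of these triangles, so in an even-cycle
-- decomposition two different cycles run along every spoke. This would be a
-- cycle cover of the Petersen graph using each spoke twice and each pentagon
-- edge once, and there is none.
--
-- A branch set of a K₅ minor has at least four neighbours, so it contains two
-- vertices of the Petersen graph; there are only ten, so the branch sets are
-- the edges of a perfect matching. By the girth, any two of them are joined by
-- one link only. Hence the re-signing that exhibits an odd K₅ makes a pentagon
-- edge positive exactly when it belongs to the matching. The outer cycle is odd
-- and the inner one even, so the matching has an even number of outer and an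
-- odd number of inner edges; but a perfect matching with s spokes has
-- (5 - s) / 2 of each.

open import Defs
open import Data.Bool as Bool using (Bool; true; false; not; _xor_; _∧_; _∨_)
open import Data.Bool.Properties using (xor-comm; xor-same; xor-identityʳ; not-involutive; not-¬; ¬-not)
open import Data.Bool.Solver using (module xor-∧-Solver)
open import Data.Empty using (⊥)
open import Data.Fin as Fin using (Fin; zero; suc; toℕ; _≟_; #_; _↑ˡ_; _↑ʳ_; splitAt; punchIn; punchOut; remQuot)
open import Data.Fin.Properties using (all?; any?; toℕ-fromℕ<; toℕ-injective; toℕ<n; toℕ-inject₁;
  ↑ˡ-injective; ↑ʳ-injective; splitAt-↑ˡ; splitAt-↑ʳ; combine-remQuot; pigeonhole; <⇒notInjective; <⇒≢;
  punchInᵢ≢i; punchIn-injective; punchIn-punchOut; punchOut-punchIn; punchOut-cong; punchOut-injective)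
open import Data.Fin.Subset using (Subset; inside; outside; _∈_; _∉_; ∁; ⁅_⁆; ∣_∣)
open import Data.Fin.Subset.Properties using (_∈?_; x∈⁅y⁆⇒x≡y; x∈∁p⇒x∉p; x∉p⇒x∈∁p; anySubset?)
open import Data.Maybe using (Maybe; just; nothing; _>>=_)
open import Data.Maybe.Properties as Maybe using (just-injective)
open import Data.Nat as ℕ using (ℕ; zero; suc; NonZero; _+_; z≤n; s≤s; s<s; _%_)
open import Data.Nat.Divisibility using (_∣_; _∣?_; divides)
open import Data.Nat.DivMod using (m<n⇒m%n≡m; n%n≡0)
import Data.Nat.Properties as ℕ
open import Data.Product as Prod using (∃; ∃-syntax; Σ-syntax; _×_; _,_; proj₁; proj₂)
open import Data.Product.Properties as Prod using (,-injectiveˡ; ,-injectiveʳ)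
open import Data.Sum as Sum using (_⊎_; inj₁; inj₂; [_,_]′)
open import Data.Vec as Vec using (Vec; lookup; tabulate; replicate; _∷_; []; _++_; here; there)
open import Data.Vec.Properties as Vec using (lookup∘tabulate; lookup-replicate; []=⇒lookup; lookup⇒[]=)
open import Function.Base using (_∘_)
open import Function.Bundles using (Inverse; Equivalence)
open import Relation.Binary.Construct.Closure.ReflexiveTransitive as Star using (Star; ε; _◅_; _◅◅_)
open import Relation.Binary.PropositionalEquality
open import Relation.Nullary using (¬_; Dec; does; yes; no; contradiction; ¬?)
open import Relation.Nullary.Decidable using (toWitness; toWitnessFalse; map′; _×-dec_; _⊎-dec_; _→-dec_;
  decidable-stable; dec-true; dec-false)

open xor-∧-Solver using (solve; _:+_; _:=_; con)

-- Minors as branch sets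

sign : (S : SignedGraph) → Fin (#E S) → Bool
sign S = lookup (signature S)

-- The value `nothing` marks a vertex in no branch set.
Labelling : ℕ → ℕ → Set
Labelling n k = Fin n → Maybe (Bool × Fin k)

module _ (S : SignedGraph) {k} (α : Labelling (#V S) k) where

  -- An edge of sign s after re-signing, between the branch sets x and y.
  Crossing : Bool → Fin k → Fin k → Set
  Crossing s x y = ∃[ e ] ∃[ u ] ∃[ v ] ∃[ b ] ∃[ c ]
    Joins (graph S) e u v × α u ≡ just (b , x) × α v ≡ just (c , y) ×
    s ≡ (b xor c) xor sign S e

  -- A positive edge after re-signing, inside the branch set x.
  Inner : Fin k → Fin (#V S) → Fin (#V S) → Set
  Inner x u v = ∃[ e ] ∃[ b ] ∃[ c ]
    Joins (graph S) e u v × α u ≡ just (b , x) × α v ≡ just (c , x) ×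
    sign S e ≡ b xor c

-- A minor in the sense of branch sets: a vertex labelled just (b , x) lies in
-- the branch set of x, and b tells whether it is re-signed.
record Model (S T : SignedGraph) : Set where
  field
    label    : Labelling (#V S) (#V T)
    crossing : ∀ {e x y} → Joins (graph T) e x y → Crossing S label (sign T e) x y
    connects : ∀ {x u v b c} → label u ≡ just (b , x) → label v ≡ just (c , x) →
               Star (Inner S label x) u v

open Model

module _ {S T U : SignedGraph} (M : Model S T) (M′ : Model T U) where

  private
    α = label M
    β = label M′

    flip-by : Bool → Bool × Fin (#V U) → Maybe (Bool × Fin (#V U))
    flip-by b (c , z) = just (b xor c , z)

    γ : Labelling (#V S) (#V U)
    γ u = α u >>= λ (b , x) → β x >>= flip-by b

    γ-just : ∀ {u b x c z} → α u ≡ just (b , x) → β x ≡ just (c , z) → γ u ≡ just (b xor c , z)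
    γ-just p q rewrite p | q = refl

    γ-just⁻¹ : ∀ {u d z} → γ u ≡ just (d , z) →
               ∃[ b ] ∃[ x ] ∃[ c ] α u ≡ just (b , x) × β x ≡ just (c , z)
    γ-just⁻¹ {u} r with α u
    ... | just (b , x) with β x in q
    γ-just⁻¹ refl | just (b , x) | just (c , z) = b , x , c , refl , q

    within : ∀ {x c z u v} → β x ≡ just (c , z) → Inner S α x u v → Inner S γ z u v
    within {c = c} q (e , b , b′ , j , p , p′ , s) =
      e , b xor c , b′ xor c , j , γ-just p q , γ-just p′ q ,
      trans s (solve 3 (λ b b′ c → b :+ b′ := (b :+ c) :+ (b′ :+ c)) refl b b′ c)

    -- Lifts a path of `T` to `S`: each of its edges is realised by a crossing edge of `M`, and
    -- `connects M` bridges the gap between one crossing edge and the next.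
    walk : ∀ {x y z u v b b′ c c′} → β x ≡ just (c , z) → β y ≡ just (c′ , z) →
           Star (Inner T β z) x y →
           α u ≡ just (b , x) → α v ≡ just (b′ , y) → Star (Inner S γ z) u v
    walk q _ ε p p′ = Star.map (within q) (connects M p p′)
    walk {z = z} q q′ ((e , c , d , j , r , r′ , s) ◅ steps) p p′ =
      let f , u₁ , v₁ , b₁ , d₁ , j₁ , p₁ , p₂ , s₁ = crossing M j in
      Star.map (within q) (connects M p p₁) ◅◅
      (f , b₁ xor c , d₁ xor d , j₁ , γ-just p₁ r , γ-just p₂ r′ ,
       -- By `s₁` the bits of `M` turn the sign of `f` into that of `e`, and by `s` those of `M′`
       -- make it positive.
       trans (solve 3 (λ b d t → t := (b :+ d) :+ ((b :+ d) :+ t)) refl b₁ d₁ (sign S f))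
         (trans (cong ((b₁ xor d₁) xor_) (trans (sym s₁) s))
           (solve 4 (λ b d c c′ → (b :+ d) :+ (c :+ c′) := (b :+ c) :+ (d :+ c′)) refl b₁ d₁ c d))) ◅
      walk r′ q′ steps p₂ p′

  compose : Model S U
  compose .label = γ
  compose .crossing j =
    let e , x , y , c , d , j₁ , q , q′ , s = crossing M′ j
        f , u , v , a , b , j₂ , p , p′ , t = crossing M j₁
    in f , u , v , a xor c , b xor d , j₂ , γ-just p q , γ-just p′ q′ ,
       trans s (trans (cong ((c xor d) xor_) t)
         (solve 5 (λ a b c d s → (c :+ d) :+ ((a :+ b) :+ s) := ((a :+ c) :+ (b :+ d)) :+ s)
           refl a b c d (sign S f)))
  compose .connects p p′ =
    let _ , _ , _ , q , r    = γ-just⁻¹ p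
        _ , _ , _ , q′ , r′ = γ-just⁻¹ p′
    in walk r r′ (connects M′ r r′) q q′

-- Minor operations and isomorphisms as models

lookup-△ : ∀ {m} (N N′ : Subset m) e → lookup (N △ N′) e ≡ lookup N e xor lookup N′ e
lookup-△ (false ∷ _) (false ∷ _) zero = refl
lookup-△ (false ∷ _) (true ∷ _) zero = refl
lookup-△ (true ∷ _) (false ∷ _) zero = refl
lookup-△ (true ∷ _) (true ∷ _) zero = refl
lookup-△ (_ ∷ N) (_ ∷ N′) (suc e) = lookup-△ N N′ e

∉⇒lookup : ∀ {m} {N : Subset m} {e} → e ∉ N → lookup N e ≡ false
∉⇒lookup {N = N} {e} e∉N with lookup N e in eq
... | false = refl
... | true  = contradiction (lookup⇒[]= e N eq) e∉N

lookup-δ : ∀ {n m} (G : Graph n m) X {e u v} → Joins G e u v →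
           lookup (δ G X) e ≡ lookup X u xor lookup X v
lookup-δ G X {e} j with lookup∘tabulate (λ e → lookup X (proj₁ (ends G e)) xor lookup X (proj₂ (ends G e))) e
lookup-δ G X (inj₁ refl) | eq = eq
lookup-δ G X (inj₂ refl) | eq = trans eq (xor-comm (lookup X _) _)

-- Only re-signing sets bits, those of `X`. Only contraction can merge vertices, and as the
-- contracted edge is positive, it connects its branch set with all bits `false`.
⟶⇒Model : ∀ {S T} → S ⟶ T → Model S T
⟶⇒Model (resign {G = G} {N} {N′} X eq) = record
  { label    = λ u → just (lookup X u , u)
  ; crossing = λ {e} {x} {y} j → e , x , y , lookup X x , lookup X y , j , refl , refl ,
      trans (solve 2 (λ s t → t := (s :+ t) :+ s) refl (lookup N e) (lookup N′ e))
        (cong (_xor lookup N e)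
          (trans (sym (lookup-△ N N′ e)) (trans (cong (λ p → lookup p e) eq) (lookup-δ G X j))))
  ; connects = λ { refl refl → ε }
  }
⟶⇒Model (deleteEdge {N = N} e) = record
  { label    = λ u → just (false , u)
  ; crossing = λ {f} {x} {y} j → punchIn e f , x , y , false , false , j , refl , refl ,
      lookup∘tabulate _ f
  ; connects = λ { refl refl → ε }
  }
⟶⇒Model (deleteVertex {n} {m} {m′} {G} {G′} {N} v ι _ _ agree) = record
  { label    = survivor
  ; crossing = λ {f} {x} {y} j → ι f , punchIn v x , punchIn v y , false , false , lift f j ,
      survivor-punchIn x , survivor-punchIn y , lookup∘tabulate _ f
  ; connects = λ p q → subst (Star _ _) (trans (sym (survivor⁻¹ p)) (survivor⁻¹ q)) ε
  }
  where
  survivor : Labelling (suc n) n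
  survivor u with v ≟ u
  ... | yes _  = nothing
  ... | no v≢u = just (false , punchOut v≢u)

  survivor-punchIn : ∀ x → survivor (punchIn v x) ≡ just (false , x)
  survivor-punchIn x with v ≟ punchIn v x
  ... | yes eq = contradiction (sym eq) (punchInᵢ≢i v x)
  ... | no neq = cong (λ z → just (false , z)) (trans (punchOut-cong v refl) (punchOut-punchIn v))

  survivor⁻¹ : ∀ {u b x} → survivor u ≡ just (b , x) → punchIn v x ≡ u
  survivor⁻¹ {u} eq with v ≟ u
  survivor⁻¹ refl | no v≢u = punchIn-punchOut v≢u

  lift : ∀ f {x y} → Joins G′ f x y → Joins G (ι f) (punchIn v x) (punchIn v y)
  lift f j with agree f
  lift f (inj₁ eq) | r = inj₁ (trans r (cong (Prod.map (punchIn v) (punchIn v)) eq))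
  lift f (inj₂ eq) | r = inj₂ (trans r (cong (Prod.map (punchIn v) (punchIn v)) eq))
⟶⇒Model (contract {G = G} {N} e e∉N π _ identifies) = record
  { label    = λ u → just (false , π u)
  ; crossing = lift
  ; connects = glue
  }
  where
  lift : ∀ {f x y} → Joins (mkGraph (Prod.map π π ∘ ends G ∘ punchIn e)) f x y →
         Crossing ⟨ G , N ⟩ (λ u → just (false , π u)) (lookup (restrict (punchIn e) N) f) x y
  lift {f} (inj₁ refl) = punchIn e f , _ , _ , false , false , inj₁ refl , refl , refl , lookup∘tabulate _ f
  lift {f} (inj₂ refl) = punchIn e f , _ , _ , false , false , inj₂ refl , refl , refl , lookup∘tabulate _ f

  glue : ∀ {x u v b c} → just (false , π u) ≡ just (b , x) → just (false , π v) ≡ just (c , x) →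
         Star (Inner ⟨ G , N ⟩ (λ u → just (false , π u)) x) u v
  glue {u = u} {v} refl q with Equivalence.to (identifies u v) (sym (,-injectiveʳ (just-injective q)))
  ... | inj₁ refl = ε
  ... | inj₂ j = (e , false , false , j , refl ,
                  cong (λ z → just (false , z)) (,-injectiveʳ (just-injective q)) , ∉⇒lookup e∉N) ◅ ε

idModel : ∀ {S} → Model S S
idModel {S} = record
  { label    = λ u → just (false , u)
  ; crossing = λ {e} j → e , _ , _ , false , false , j , refl , refl , refl
  ; connects = λ { refl refl → ε }
  }

⟶*⇒Model : ∀ {S T} → Star _⟶_ S T → Model S T
⟶*⇒Model ε        = idModel
⟶*⇒Model (s ◅ ss) = compose (⟶⇒Model s) (⟶*⇒Model ss)

⇔⇒lookup≡ : ∀ {m m′} {N : Subset m} {N′ : Subset m′} {e e′} → (e ∈ N → e′ ∈ N′) → (e′ ∈ N′ → e ∈ N) →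
            lookup N′ e′ ≡ lookup N e
⇔⇒lookup≡ {N = N} {N′} {e} {e′} to from with lookup N e in p | lookup N′ e′ in q
... | false | false = refl
... | true  | true  = refl
... | true  | false with () ← trans (sym q) ([]=⇒lookup (to (lookup⇒[]= e N p)))
... | false | true  with () ← trans (sym p) ([]=⇒lookup (from (lookup⇒[]= e′ N′ q)))

≅⇒Model : ∀ {S T} → S ≅ T → Model S T
≅⇒Model {S} {T} iso = record
  { label    = λ u → just (false , f u)
  ; crossing = lift
  ; connects = λ {x} {u} p q → subst (Star _ u)
      (f-injective (trans (,-injectiveʳ (just-injective p)) (sym (,-injectiveʳ (just-injective q))))) ε
  }
  where
  open _≅_ iso
  open Inverse onV using () renaming (to to f)
  open Inverse onE using () renaming (to to g; from to g⁻¹)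

  f-injective : ∀ {u v} → f u ≡ f v → u ≡ v
  f-injective {u} {v} eq = trans (sym (Inverse.strictlyInverseʳ onV u))
    (trans (cong (Inverse.from onV) eq) (Inverse.strictlyInverseʳ onV v))

  lift : ∀ {e x y} → Joins (graph T) e x y → Crossing S (λ u → just (false , f u)) (sign T e) x y
  lift {e} j with g⁻¹ e | Inverse.strictlyInverseˡ onE e
  ... | d | refl with onEnds d | j | onSignature d
  ... | inj₁ p | inj₁ q | s with refl ← trans (sym p) q =
        d , _ , _ , false , false , inj₁ refl , refl , refl , ⇔⇒lookup≡ (Equivalence.to s) (Equivalence.from s)
  ... | inj₁ p | inj₂ q | s with refl ← trans (sym p) q =
        d , _ , _ , false , false , inj₂ refl , refl , refl , ⇔⇒lookup≡ (Equivalence.to s) (Equivalence.from s)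
  ... | inj₂ p | inj₁ q | s with refl ← trans (sym p) q =
        d , _ , _ , false , false , inj₂ refl , refl , refl , ⇔⇒lookup≡ (Equivalence.to s) (Equivalence.from s)
  ... | inj₂ p | inj₂ q | s with refl ← trans (sym p) q =
        d , _ , _ , false , false , inj₁ refl , refl , refl , ⇔⇒lookup≡ (Equivalence.to s) (Equivalence.from s)

HasMinor⇒Model : ∀ {S T} → HasMinor S T → Model S T
HasMinor⇒Model (_ , steps , iso) = compose (⟶*⇒Model steps) (≅⇒Model iso)

-- Even cycles

module _ {k : ℕ} .{{_ : NonZero k}} where

  toℕ-cyclicSuc : (i : Fin k) →
    toℕ (cyclicSuc i) ≡ suc (toℕ i) ⊎ (suc (toℕ i) ≡ k × toℕ (cyclicSuc i) ≡ 0)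
  toℕ-cyclicSuc i with ℕ.m<1+n⇒m<n∨m≡n (s<s (toℕ<n i))
  ... | inj₁ lt = inj₁ (trans (toℕ-fromℕ< _) (m<n⇒m%n≡m lt))
  ... | inj₂ eq = inj₂ (eq , trans (toℕ-fromℕ< _) (trans (cong (_% k) eq) (n%n≡0 k)))

  cyclicSuc-injective : ∀ {i j : Fin k} → cyclicSuc i ≡ cyclicSuc j → i ≡ j
  cyclicSuc-injective {i} {j} eq with toℕ-cyclicSuc i | toℕ-cyclicSuc j | cong toℕ eq
  ... | inj₁ p       | inj₁ q       | r = toℕ-injective (ℕ.suc-injective (trans (sym p) (trans r q)))
  ... | inj₁ p       | inj₂ (_ , q) | r = contradiction (trans (sym q) (trans (sym r) p)) ℕ.0≢1+n
  ... | inj₂ (_ , p) | inj₁ q       | r = contradiction (trans (sym p) (trans r q)) ℕ.0≢1+n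
  ... | inj₂ (p , _) | inj₂ (q , _) | _ = toℕ-injective (ℕ.suc-injective (trans p (sym q)))

cyclicSuc-surjective : ∀ {k} .{{_ : NonZero k}} (i : Fin k) → ∃[ j ] cyclicSuc j ≡ i
cyclicSuc-surjective {suc k} zero = j , toℕ-injective (go (toℕ-cyclicSuc j))
  where
  -- The last position, where `cyclicSuc` wraps around.
  j = Fin.fromℕ< (ℕ.n<1+n k)
  go : _ → toℕ (cyclicSuc j) ≡ 0
  go (inj₂ (_ , eq)) = eq
  go (inj₁ eq) = contradiction (trans eq (cong suc (toℕ-fromℕ< _))) (ℕ.<⇒≢ (toℕ<n (cyclicSuc j)))
cyclicSuc-surjective {suc k} (suc i) = j , toℕ-injective (go (toℕ-cyclicSuc j))
  where
  j = Fin.inject₁ i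
  go : _ → toℕ (cyclicSuc j) ≡ suc (toℕ i)
  go (inj₁ eq) = trans eq (cong suc (toℕ-inject₁ i))
  go (inj₂ (eq , _)) = contradiction (trans (cong suc (sym (toℕ-inject₁ i))) eq) (ℕ.<⇒≢ (s<s (toℕ<n i)))

parity : ℕ → Bool
parity zero    = false
parity (suc n) = not (parity n)

even⇒parity : ∀ {n} → 2 ∣ n → parity n ≡ false
even⇒parity (divides zero    refl) = refl
even⇒parity (divides (suc q) refl) = trans (not-involutive _) (even⇒parity (divides q refl))

-- Evenness of `k` enters at the wrap-around from `k - 1` to `0`.
parity-cyclicSuc : ∀ {k} .{{_ : NonZero k}} → 2 ∣ k → (i : Fin k) →
                   parity (toℕ (cyclicSuc i)) ≡ not (parity (toℕ i))
parity-cyclicSuc 2∣k i with toℕ-cyclicSuc i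
... | inj₁ eq         = cong parity eq
... | inj₂ (eq , eq′) = trans (cong parity eq′) (sym (trans (cong parity eq) (even⇒parity 2∣k)))

module _ {n m} {G : Graph n m} where

  Adjacent : Fin m → Fin m → Set
  Adjacent e f = ∃[ v ] Incident G v e × Incident G v f

  module _ (C : Cycle G) (even : 2 ∣ len C) where

    colour : Fin (len C) → Bool
    colour i = parity (toℕ i)

    incident : ∀ {v} i → Incident G v (edge C i) → v ≡ vertex C i ⊎ v ≡ vertex C (cyclicSuc i)
    incident i (u , j) with joins C i | j
    ... | inj₁ p | inj₁ q with refl ← trans (sym p) q = inj₂ refl
    ... | inj₁ p | inj₂ q with refl ← trans (sym p) q = inj₁ refl
    ... | inj₂ p | inj₁ q with refl ← trans (sym p) q = inj₁ refl
    ... | inj₂ p | inj₂ q with refl ← trans (sym p) q = inj₂ refl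

    alternate : ∀ i → colour i ≢ colour (cyclicSuc i)
    alternate i eq = not-¬ (sym eq) (parity-cyclicSuc even i)

    -- A vertex shared by two edges of the cycle is the start of one and the end of the other, so
    -- their positions are consecutive.
    adjacent⇒≢ : ∀ {i j} → i ≢ j → Adjacent (edge C i) (edge C j) → colour i ≢ colour j
    adjacent⇒≢ {i} {j} i≢j (v , p , q) with incident i p | incident j q
    ... | inj₁ r | inj₁ s = contradiction (vertex-injective C (trans (sym r) s)) i≢j
    ... | inj₁ r | inj₂ s with refl ← vertex-injective C (trans (sym r) s) = alternate j ∘ sym
    ... | inj₂ r | inj₁ s with refl ← vertex-injective C (trans (sym r) s) = alternate i
    ... | inj₂ r | inj₂ s = contradiction (cyclicSuc-injective (vertex-injective C (trans (sym r) s))) i≢j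

    partner-in-cycle : ∀ {v} i → Incident G v (edge C i) →
                       ∃[ j ] j ≢ i × Incident G v (edge C j)
    partner-in-cycle i p with incident i p
    ... | inj₁ refl =
            let j , eq = cyclicSuc-surjective i in
            -- This excludes a loop: with `j = i` a position would have the colour of its successor.
            j , (λ j≡i → alternate j (cong colour (trans j≡i (sym eq)))) ,
            vertex C j , subst (Joins G (edge C j) (vertex C j)) (cong (vertex C) eq) (joins C j)
    ... | inj₂ refl = cyclicSuc i , (λ eq → alternate i (cong colour (sym eq))) , _ , Sum.swap (joins C (cyclicSuc i))

module _ {n m} {G : Graph n m} (dec : EvenCycleDecomposable G) where

  private
    C     = proj₁ (proj₂ dec)
    even  = proj₁ (proj₂ (proj₂ dec))
    cover = proj₂ (proj₂ (proj₂ dec))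

  -- An edge colouring with the cycles as its classes, not to be confused with the position parity
  -- `colour`.
  colourOf : Fin m → Fin (proj₁ dec)
  colourOf e = proj₁ (cover e)

  position : ∀ {e i} → colourOf e ≡ i → ∃[ j ] edge (C i) j ≡ e
  position {e} refl = proj₁ (proj₂ (cover e))

  partner : ∀ {v e} → Incident G v e → ∃[ f ] f ≢ e × Incident G v f × colourOf f ≡ colourOf e
  partner {v} {e} p =
    let i , eq       = position {e} refl
        j , j≢i , q = partner-in-cycle (C _) (even _) i (subst (Incident G v) (sym eq) p)
    in edge (C _) j , (λ r → j≢i (edge-injective (C _) (trans r (sym eq)))) , q ,
       proj₂ (proj₂ (cover _)) (j , refl)

  -- Adjacent edges of an even cycle differ in the parity of their position.
  noThreeAdjacent : ∀ {c e f g} → colourOf e ≡ c → colourOf f ≡ c → colourOf g ≡ c →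
    e ≢ f → f ≢ g → g ≢ e →
    Adjacent {G = G} e f → Adjacent {G = G} f g → ¬ Adjacent {G = G} g e
  noThreeAdjacent {c} p q r e≢f f≢g g≢e ef fg ge
    with _ , refl ← position p | _ , refl ← position q | _ , refl ← position r
    = adjacent⇒≢ (C c) (even c) (g≢e ∘ cong (edge (C c))) ge
        (trans (¬-not (adjacent⇒≢ (C c) (even c) (f≢g ∘ cong (edge (C c))) fg ∘ sym))
          (sym (¬-not (adjacent⇒≢ (C c) (even c) (e≢f ∘ cong (edge (C c))) ef))))

-- The counterexample

-- The outer vertices are 0-4, the inner ones 5-9, with 5 + i opposite to i. The
-- outer edges are 0-4, the inner ones 5-8 and 14, and the spokes 9-13.
petersen : Graph 10 15
petersen = mkGraph (lookup
  ( (# 0 , # 1) ∷ (# 1 , # 2) ∷ (# 2 , # 3) ∷ (# 3 , # 4) ∷ (# 4 , # 0)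
  ∷ (# 5 , # 7) ∷ (# 6 , # 8) ∷ (# 7 , # 9) ∷ (# 8 , # 5)
  ∷ (# 0 , # 5) ∷ (# 1 , # 6) ∷ (# 2 , # 7) ∷ (# 3 , # 8) ∷ (# 4 , # 9)
  ∷ (# 9 , # 6) ∷ []))

direct : Fin 14 → Fin 15
direct ℓ = ℓ ↑ˡ 1

subdivided : Fin 6 → Fin 15
subdivided s = 9 ↑ʳ s

core : Fin 10 → Fin 16
core v = v ↑ˡ 6

middle : Fin 6 → Fin 16
middle s = 10 ↑ʳ s

-- Every edge of the Petersen graph but the last is kept, and the edge 9 + s gives
-- rise to a path with edges 14 + s and 20 + s through the vertex 10 + s.
counterexample : Graph 16 (14 + (6 + 6))
counterexample = mkGraph ([ directEnds , [ firstHalf , secondHalf ]′ ∘ splitAt 6 ]′ ∘ splitAt 14)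
  where
  directEnds : Fin 14 → Fin 16 × Fin 16
  directEnds ℓ = Prod.map core core (ends petersen (direct ℓ))

  firstHalf secondHalf : Fin 6 → Fin 16 × Fin 16
  firstHalf  s = core (proj₁ (ends petersen (subdivided s))) , middle s
  secondHalf s = middle s , core (proj₂ (ends petersen (subdivided s)))

-- No even-cycle decomposition

incident? : ∀ {n m} (G : Graph n m) v e → Dec (Incident G v e)
incident? G v e = map′
  (λ { (inj₁ refl) → _ , inj₂ refl ; (inj₂ refl) → _ , inj₁ refl })
  (λ { (_ , inj₁ refl) → inj₂ refl ; (_ , inj₂ refl) → inj₁ refl })
  (v ≟ proj₁ (ends G e) ⊎-dec v ≟ proj₂ (ends G e))

module _ {n m} (G : Graph n m) where

  -- A triangle p q s whose vertex s has degree two and whose vertex p has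
  -- two further edges x and y.
  record Corner : Set where
    constructor corner
    field
      p q s         : Fin n
      x y d s₁ s₂ : Fin m

  IsCorner : Corner → Set
  IsCorner (corner p q s x y d s₁ s₂) =
    (∀ e → Incident G p e → e ≡ x ⊎ e ≡ y ⊎ e ≡ d ⊎ e ≡ s₁) ×
    (∀ e → Incident G s e → e ≡ s₁ ⊎ e ≡ s₂) ×
    (Incident G p d × Incident G p s₁ × Incident G s s₁ ×
     Incident G s s₂ × Incident G q s₂ × Incident G q d) ×
    d ≢ s₁ × s₁ ≢ s₂ × s₂ ≢ d

  isCorner? : ∀ c → Dec (IsCorner c)
  isCorner? (corner p q s x y d s₁ s₂) =
    all? (λ e → incident? G p e →-dec (e ≟ x ⊎-dec e ≟ y ⊎-dec e ≟ d ⊎-dec e ≟ s₁)) ×-dec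
    all? (λ e → incident? G s e →-dec (e ≟ s₁ ⊎-dec e ≟ s₂)) ×-dec
    (incident? G p d ×-dec incident? G p s₁ ×-dec incident? G s s₁ ×-dec
     incident? G s s₂ ×-dec incident? G q s₂ ×-dec incident? G q d) ×-dec
    ¬? (d ≟ s₁) ×-dec ¬? (s₁ ≟ s₂) ×-dec ¬? (s₂ ≟ d)

SamePair : {A : Set} (u v a b : A) → Set
SamePair u v a b = (u ≡ a × v ≡ b) ⊎ (u ≡ b × v ≡ a)

SamePair-join : ∀ {A : Set} {u v u′ v′ a b : A} →
                SamePair u v a b → SamePair u′ v′ a b → SamePair u′ v′ u v
SamePair-join (inj₁ (refl , refl)) p = p
SamePair-join (inj₂ (refl , refl)) (inj₁ p) = inj₂ p
SamePair-join (inj₂ (refl , refl)) (inj₂ p) = inj₁ p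

module _ {n m} {G : Graph n m} (dec : EvenCycleDecomposable G) where

  private
    κ = colourOf dec

  -- A cycle that enters `s` by one of its two edges leaves by the other.
  degreeTwo : ∀ {s s₁ s₂} → (∀ e → Incident G s e → e ≡ s₁ ⊎ e ≡ s₂) →
              Incident G s s₁ → κ s₁ ≡ κ s₂
  degreeTwo only i with partner dec i
  ... | f , f≢s₁ , j , eq with only f j
  ... | inj₁ refl = contradiction refl f≢s₁
  ... | inj₂ refl = sym eq

  -- The three edges of the triangle cannot share a cycle, which would be odd.
  atCorner : ∀ c → IsCorner G c → let open Corner c in
             κ d ≢ κ s₁ × κ s₁ ≡ κ s₂ × SamePair (κ x) (κ y) (κ d) (κ s₁)
  atCorner (corner p q s x y d s₁ s₂)
           (only-p , only-s , (pd , ps₁ , ss₁ , ss₂ , qs₂ , qd) , d≢s₁ , s₁≢s₂ , s₂≢d) =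
    d≉s₁ , s₁≈s₂ , pairing (partner dec pd) (partner dec ps₁)
    where
    s₁≈s₂ : κ s₁ ≡ κ s₂
    s₁≈s₂ = degreeTwo only-s ss₁

    d≉s₁ : κ d ≢ κ s₁
    d≉s₁ eq = noThreeAdjacent dec eq refl (sym s₁≈s₂) d≢s₁ s₁≢s₂ s₂≢d
      (p , pd , ps₁) (s , ss₁ , ss₂) (q , qs₂ , qd)

    -- The cycles through `d` and `s₁` differ, so neither edge continues into the other at `p`; each
    -- continues into `x` or `y`, and not both into the same.
    pairing : (∃[ f ] f ≢ d × Incident G p f × κ f ≡ κ d) →
              (∃[ f ] f ≢ s₁ × Incident G p f × κ f ≡ κ s₁) →
              SamePair (κ x) (κ y) (κ d) (κ s₁)
    pairing (f , f≢d , pf , f≈d) (g , g≢s₁ , pg , g≈s₁) with only-p f pf | only-p g pg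
    ... | inj₁ refl                      | inj₁ refl               = contradiction (trans (sym f≈d) g≈s₁) d≉s₁
    ... | inj₁ refl                      | inj₂ (inj₁ refl)        = inj₁ (f≈d , g≈s₁)
    ... | inj₂ (inj₁ refl)               | inj₁ refl               = inj₂ (g≈s₁ , f≈d)
    ... | inj₂ (inj₁ refl)               | inj₂ (inj₁ refl)        = contradiction (trans (sym f≈d) g≈s₁) d≉s₁
    ... | inj₂ (inj₂ (inj₁ refl))        | _                       = contradiction refl f≢d
    ... | inj₂ (inj₂ (inj₂ refl))        | _                       = contradiction (sym f≈d) d≉s₁
    ... | _                              | inj₂ (inj₂ (inj₁ refl)) = contradiction g≈s₁ d≉s₁
    ... | _                              | inj₂ (inj₂ (inj₂ refl)) = contradiction refl g≢s₁

-- aᵢ is the cycle through the outer edge from i to i + 1, and cᵢ the one through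
-- the inner edge from i to i + 2; the condition at i says that the spoke at i is
-- covered by the same two cycles at both of its ends.
pentagons : ∀ {A : Set} {a0 a1 a2 a3 a4 c0 c1 c2 c3 c4 : A} →
  a4 ≢ a0 → a0 ≢ a1 → a1 ≢ a2 → a2 ≢ a3 → a3 ≢ a4 →
  SamePair c3 c0 a4 a0 → SamePair c0 c2 a1 a2 → SamePair c2 c4 a3 a4 → SamePair c4 c1 a0 a1 → ⊥
pentagons _ n _ _ _ (inj₁ (refl , refl)) (inj₁ (refl , refl)) _ _ = n refl
pentagons n _ _ _ _ (inj₁ (refl , refl)) (inj₂ (refl , refl)) (inj₁ (refl , refl)) (inj₁ (refl , refl)) = n refl
pentagons _ _ _ _ n (inj₁ (refl , refl)) (inj₂ (refl , refl)) (inj₁ (refl , refl)) (inj₂ (refl , refl)) = n refl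
pentagons _ _ _ n _ (inj₁ (refl , refl)) (inj₂ (refl , refl)) (inj₂ (refl , refl)) (inj₁ (refl , refl)) = n refl
pentagons _ _ _ _ n (inj₁ (refl , refl)) (inj₂ (refl , refl)) (inj₂ (refl , refl)) (inj₂ (refl , refl)) = n refl
pentagons _ _ _ n _ (inj₂ (refl , refl)) (inj₁ (refl , refl)) (inj₁ (refl , refl)) _ = n refl
pentagons _ _ n _ _ (inj₂ (refl , refl)) (inj₁ (refl , refl)) (inj₂ (refl , refl)) _ = n refl
pentagons n _ _ _ _ (inj₂ (refl , refl)) (inj₂ (refl , refl)) (inj₁ (refl , refl)) (inj₁ (refl , refl)) = n refl
pentagons _ _ n _ _ (inj₂ (refl , refl)) (inj₂ (refl , refl)) (inj₁ (refl , refl)) (inj₂ (refl , refl)) = n refl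
pentagons _ _ n _ _ (inj₂ (refl , refl)) (inj₂ (refl , refl)) (inj₂ (refl , refl)) _ = n refl

SamePair-≢ : ∀ {A : Set} {u v a b : A} → a ≢ b → SamePair u v a b → u ≢ v
SamePair-≢ a≢b (inj₁ (refl , refl)) = a≢b
SamePair-≢ a≢b (inj₂ (refl , refl)) = a≢b ∘ sym

prev : Fin 5 → Fin 5
prev = lookup (# 4 ∷ # 0 ∷ # 1 ∷ # 2 ∷ # 3 ∷ [])

-- The triangle at spoke `i` seen from its two ends, which swaps the halves `14 + i` and `20 + i`.
-- At the inner vertices 6 and 9 one pentagon edge is a half of the subdivided edge, 25 or 19.
outerCorner innerCorner : Fin 5 → Corner counterexample
outerCorner i = corner (i ↑ˡ 11) (5 ↑ʳ (i ↑ˡ 6)) (10 ↑ʳ (i ↑ˡ 1))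
  (prev i ↑ˡ 21) (i ↑ˡ 21) (9 ↑ʳ (i ↑ˡ 12)) (14 ↑ʳ (i ↑ˡ 7)) (20 ↑ʳ (i ↑ˡ 1))
innerCorner i = corner (5 ↑ʳ (i ↑ˡ 6)) (i ↑ˡ 11) (10 ↑ʳ (i ↑ˡ 1))
  (lookup (# 8 ∷ # 25 ∷ # 5 ∷ # 6 ∷ # 7 ∷ []) i) (lookup (# 5 ∷ # 6 ∷ # 7 ∷ # 8 ∷ # 19 ∷ []) i)
  (9 ↑ʳ (i ↑ˡ 12)) (20 ↑ʳ (i ↑ˡ 1)) (14 ↑ʳ (i ↑ˡ 7))

corners : ∀ i → IsCorner counterexample (outerCorner i) × IsCorner counterexample (innerCorner i)
corners = toWitness {a? = all? λ i → isCorner? _ (outerCorner i) ×-dec isCorner? _ (innerCorner i)} _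

counterexample-¬decomposable : ¬ EvenCycleDecomposable counterexample
counterexample-¬decomposable dec =
  pentagons (apart zero) (apart (# 1)) (apart (# 2)) (apart (# 3)) (apart (# 4))
    (joint zero) (joint (# 2))
    -- The edge `c4` is the subdivided one: spoke 4 meets its half 19 and spoke 1 its half 25, both
    -- in the same cycle.
    (subst (λ c → SamePair (κ (# 7)) c (κ (# 3)) (κ (# 4))) halves (joint (# 4))) (joint (# 1))
  where
  κ = colourOf dec

  apart : ∀ i → κ (Corner.x (outerCorner i)) ≢ κ (Corner.y (outerCorner i))
  apart i = let d≉s₁ , _ , pair = atCorner dec _ (proj₁ (corners i)) in SamePair-≢ d≉s₁ pair

  joint : ∀ i → SamePair (κ (Corner.x (innerCorner i))) (κ (Corner.y (innerCorner i)))
                         (κ (Corner.x (outerCorner i))) (κ (Corner.y (outerCorner i)))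
  joint i =
    let _ , s₁≈s₂ , pair = atCorner dec _ (proj₁ (corners i))
        _ , _ , pair′ = atCorner dec _ (proj₂ (corners i))
    in SamePair-join pair (subst (SamePair _ _ _) (sym s₁≈s₂) pair′)

  halves : κ (# 19) ≡ κ (# 25)
  halves = degreeTwo dec
    (toWitness {a? = all? λ e → incident? counterexample (# 15) e →-dec (e ≟ # 19 ⊎-dec e ≟ # 25)} _)
    (toWitness {a? = incident? counterexample (# 15) (# 19)} _)

-- Connectivity and parity

witness : ∀ {P : Set} (P? : Dec P) → does P? ≡ true → P
witness (yes p) _ = p

module _ {n m} (G : Graph n m) where

  Avoiding : Fin n → Fin n → Fin n → Set
  Avoiding x u v = u ≢ x × v ≢ x × ∃[ e ] Joins G e u v

  Avoiding-sym : ∀ {x u v} → Avoiding x u v → Avoiding x v u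
  Avoiding-sym (p , q , e , j) = q , p , e , Sum.swap j

  -- Breadth-first search in the graph without `x`: `reached k` is the ball of radius `k` around
  -- `root`, in a form that evaluates.
  module Search (x root : Fin n) (root≢x : root ≢ x) where

    Next : Subset n → Fin n → Set
    Next S v = v ∈ S ⊎ (v ≢ x × ∃[ e ]
      ((proj₂ (ends G e) ≡ v × proj₁ (ends G e) ∈ S) ⊎ (proj₁ (ends G e) ≡ v × proj₂ (ends G e) ∈ S)))

    next? : ∀ S v → Dec (Next S v)
    next? S v = v ∈? S ⊎-dec (¬? (v ≟ x) ×-dec any? λ e →
      (proj₂ (ends G e) ≟ v ×-dec proj₁ (ends G e) ∈? S) ⊎-dec
      (proj₁ (ends G e) ≟ v ×-dec proj₂ (ends G e) ∈? S))

    reached : ℕ → Subset n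
    reached zero    = ⁅ root ⁆
    reached (suc k) = tabulate (does ∘ next? (reached k))

    sound : ∀ k {v} → v ∈ reached k → v ≢ x × Star (Avoiding x) root v
    sound zero v∈ with refl ← x∈⁅y⁆⇒x≡y _ v∈ = root≢x , ε
    sound (suc k) {v} v∈ with witness (next? (reached k) v)
      (trans (sym (lookup∘tabulate (does ∘ next? (reached k)) v)) ([]=⇒lookup v∈))
    ... | inj₁ v∈′                          = sound k v∈′
    ... | inj₂ (v≢x , e , inj₁ (refl , u∈)) =
      let u≢x , path = sound k u∈ in v≢x , path ◅◅ (u≢x , v≢x , e , inj₁ refl) ◅ ε
    ... | inj₂ (v≢x , e , inj₂ (refl , u∈)) =
      let u≢x , path = sound k u∈ in v≢x , path ◅◅ (u≢x , v≢x , e , inj₂ refl) ◅ ε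

∣p∣≡0⇒∉ : ∀ {n} (X : Subset n) → ∣ X ∣ ℕ.≤ 0 → ∀ v → v ∉ X
∣p∣≡0⇒∉ (outside ∷ X) le (suc v) (there v∈) = ∣p∣≡0⇒∉ X le v v∈

∣p∣≤1⇒unique : ∀ {n} (X : Subset n) → ∣ X ∣ ℕ.≤ 1 → ∀ {u v} → u ∈ X → v ∈ X → u ≡ v
∣p∣≤1⇒unique (inside  ∷ X) (s≤s le) here       here       = refl
∣p∣≤1⇒unique (inside  ∷ X) (s≤s le) here       (there v∈) = contradiction v∈ (∣p∣≡0⇒∉ X le _)
∣p∣≤1⇒unique (inside  ∷ X) (s≤s le) (there u∈) _          = contradiction u∈ (∣p∣≡0⇒∉ X le _)
∣p∣≤1⇒unique (outside ∷ X) le       (there u∈) (there v∈) = cong suc (∣p∣≤1⇒unique X le u∈ v∈)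

third : ∀ {n} (u v : Fin (3 + n)) → ∃[ x ] u ≢ x × v ≢ x
third (suc u)       (suc v)       = zero , (λ ()) , (λ ())
third zero          zero          = # 1 , (λ ()) , (λ ())
third zero          (suc zero)    = # 2 , (λ ()) , (λ ())
third zero          (suc (suc _)) = # 1 , (λ ()) , (λ ())
third (suc zero)    zero          = # 2 , (λ ()) , (λ ())
third (suc (suc _)) zero          = # 1 , (λ ()) , (λ ())

-- A set of fewer than two vertices lies in some `⁅ x ⁆`; if it is empty, any `x` other than `u` and
-- `v` will do, and `third` finds one.
2-connected : ∀ {n m} (G : Graph (3 + n) m) →
  (∀ x {u v} → u ≢ x → v ≢ x → Star (Avoiding G x) u v) → G is 2 -connected
2-connected G avoid = s≤s (s≤s (s≤s z≤n)) , λ X ∣X∣<2 {u} {v} u∈ v∈ →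
  let x , only , u≢x , v≢x = blocker X (ℕ.s≤s⁻¹ ∣X∣<2) u∈ v∈
      member : ∀ {w} → w ≢ x → w ∈ ∁ X
      member w≢x = x∉p⇒x∈∁p (w≢x ∘ only)
  in Star.map (λ (p , q , e) → member p , member q , e) (avoid x u≢x v≢x)
  where
  blocker : ∀ X → ∣ X ∣ ℕ.≤ 1 → ∀ {u v} → u ∈ ∁ X → v ∈ ∁ X →
            ∃[ x ] (∀ {w} → w ∈ X → w ≡ x) × u ≢ x × v ≢ x
  blocker X le {u} {v} u∈ v∈ with any? (_∈? X)
  ... | yes (x , x∈) = x , (λ w∈ → ∣p∣≤1⇒unique X le w∈ x∈) ,
                       (λ { refl → x∈∁p⇒x∉p u∈ x∈ }) , (λ { refl → x∈∁p⇒x∉p v∈ x∈ })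
  ... | no  none with x , u≢x , v≢x ← third u v = x , (λ w∈ → contradiction (_ , w∈) none) , u≢x , v≢x

root : Fin 16 → Fin 16
root zero    = # 1
root (suc _) = # 0

root≢ : ∀ x → root x ≢ x
root≢ zero    ()
root≢ (suc _) ()

open Search using (reached; sound)

-- The 4 bounds the distance from the root in the graph without `x`; this is checked by evaluation.
allReached : ∀ x → reached counterexample x (root x) (root≢ x) 4 ≡ ∁ ⁅ x ⁆
allReached = toWitness
  {a? = all? λ x → Vec.≡-dec Bool._≟_ (reached counterexample x (root x) (root≢ x) 4) (∁ ⁅ x ⁆)} _

counterexample-2-connected : counterexample is 2 -connected
counterexample-2-connected = 2-connected counterexample λ x u≢x v≢x →
  Star.reverse (Avoiding-sym counterexample) (path x u≢x) ◅◅ path x v≢x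
  where
  path : ∀ x {v} → v ≢ x → Star (Avoiding counterexample x) (root x) v
  path x v≢x = proj₂ (sound counterexample x (root x) (root≢ x) 4
    (subst (_ ∈_) (sym (allReached x)) (x∉p⇒x∈∁p (v≢x ∘ x∈⁅y⁆⇒x≡y _))))

counterexample-eulerian : Eulerian counterexample
counterexample-eulerian = toWitness {a? = all? λ v → 2 ∣? degree counterexample v} _

counterexample-loopless : Loopless counterexample
counterexample-loopless = toWitness
  {a? = all? λ e → ¬? (proj₁ (ends counterexample e) ≟ proj₂ (ends counterexample e))} _

-- The Petersen graph and its minors

joins? : ∀ {n m} (G : Graph n m) e u v → Dec (Joins G e u v)
joins? G e u v = Prod.≡-dec _≟_ _≟_ (ends G e) (u , v) ⊎-dec Prod.≡-dec _≟_ _≟_ (ends G e) (v , u)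

Joins-cases : ∀ {n m} (G : Graph n m) e {u v u′ v′} → Joins G e u v → Joins G e u′ v′ →
              (u ≡ u′ × v ≡ v′) ⊎ (u ≡ v′ × v ≡ u′)
Joins-cases _ _ (inj₁ p) (inj₁ q) with refl ← trans (sym p) q = inj₁ (refl , refl)
Joins-cases _ _ (inj₁ p) (inj₂ q) with refl ← trans (sym p) q = inj₂ (refl , refl)
Joins-cases _ _ (inj₂ p) (inj₁ q) with refl ← trans (sym p) q = inj₂ (refl , refl)
Joins-cases _ _ (inj₂ p) (inj₂ q) with refl ← trans (sym p) q = inj₁ (refl , refl)

-- Slots 0 and 1 hold the neighbours on the same pentagon, slot 2 the one across the spoke; `rim`
-- and `matched` rely on this order.
neighbour : Fin 10 → Fin 3 → Fin 10
neighbour v = lookup (lookup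
  ( (# 4 ∷ # 1 ∷ # 5 ∷ []) ∷ (# 0 ∷ # 2 ∷ # 6 ∷ []) ∷ (# 1 ∷ # 3 ∷ # 7 ∷ [])
  ∷ (# 2 ∷ # 4 ∷ # 8 ∷ []) ∷ (# 3 ∷ # 0 ∷ # 9 ∷ [])
  ∷ (# 8 ∷ # 7 ∷ # 0 ∷ []) ∷ (# 9 ∷ # 8 ∷ # 1 ∷ []) ∷ (# 5 ∷ # 9 ∷ # 2 ∷ [])
  ∷ (# 6 ∷ # 5 ∷ # 3 ∷ []) ∷ (# 7 ∷ # 6 ∷ # 4 ∷ []) ∷ []) v)

Neighbour : Fin 10 → Fin 10 → Set
Neighbour u v = ∃[ k ] neighbour u k ≡ v

neighbour? : ∀ u v → Dec (Neighbour u v)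
neighbour? u v = any? λ k → neighbour u k ≟ v

neighbour-table : ∀ ℓ → let u , v = ends petersen ℓ in Neighbour u v × Neighbour v u × u ≢ v
neighbour-table = toWitness {a? = all? λ ℓ → let u , v = ends petersen ℓ in
  neighbour? u v ×-dec neighbour? v u ×-dec ¬? (u ≟ v)} _

Joins⇒Neighbour : ∀ ℓ {u v} → Joins petersen ℓ u v → Neighbour u v
Joins⇒Neighbour ℓ (inj₁ refl) = proj₁ (neighbour-table ℓ)
Joins⇒Neighbour ℓ (inj₂ refl) = proj₁ (proj₂ (neighbour-table ℓ))

petersen-loopless : ∀ ℓ {u v} → Joins petersen ℓ u v → u ≢ v
petersen-loopless ℓ (inj₁ refl) = proj₂ (proj₂ (neighbour-table ℓ))
petersen-loopless ℓ (inj₂ refl) = proj₂ (proj₂ (neighbour-table ℓ)) ∘ sym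

Near : Fin 10 → Fin 10 → Set
Near u v = u ≡ v ⊎ Neighbour u v

near? : ∀ u v → Dec (Near u v)
near? u v = u ≟ v ⊎-dec neighbour? u v

-- The closed walk through `u`, `u′`, `v′`, `v` has length at most four. The two inequalities
-- exclude the walks that backtrack without `ℓ′` being `ℓ`, so that any other link would close a
-- short cycle.
Girth : Fin 15 → Fin 15 → Fin 10 → Fin 10 → Fin 10 → Fin 10 → Set
Girth ℓ ℓ′ u v u′ v′ = u′ ≢ v → v′ ≢ u → Near u u′ → Near v v′ → ℓ′ ≡ ℓ

girth? : ∀ ℓ ℓ′ u v u′ v′ → Dec (Girth ℓ ℓ′ u v u′ v′)
girth? ℓ ℓ′ u v u′ v′ =
  ¬? (u′ ≟ v) →-dec ¬? (v′ ≟ u) →-dec near? u u′ →-dec near? v v′ →-dec ℓ′ ≟ ℓ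

-- The Petersen graph has neither triangles nor 4-cycles.
girth-table : ∀ ℓ ℓ′ → let u , v = ends petersen ℓ ; u′ , v′ = ends petersen ℓ′ in
  Girth ℓ ℓ′ u v u′ v′ × Girth ℓ ℓ′ u v v′ u′
girth-table = toWitness {a? = all? λ ℓ → all? λ ℓ′ →
    let u , v = ends petersen ℓ ; u′ , v′ = ends petersen ℓ′ in
    girth? ℓ ℓ′ u v u′ v′ ×-dec girth? ℓ ℓ′ u v v′ u′} _

girth : ∀ ℓ ℓ′ {u v u′ v′} → Joins petersen ℓ u v → Joins petersen ℓ′ u′ v′ → Girth ℓ ℓ′ u v u′ v′
girth ℓ ℓ′ (inj₁ refl) (inj₁ refl) = proj₁ (girth-table ℓ ℓ′)
girth ℓ ℓ′ (inj₁ refl) (inj₂ refl) = proj₂ (girth-table ℓ ℓ′)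
girth ℓ ℓ′ (inj₂ refl) (inj₁ refl) = λ a b c d → proj₂ (girth-table ℓ ℓ′) b a d c
girth ℓ ℓ′ (inj₂ refl) (inj₂ refl) = λ a b c d → proj₁ (girth-table ℓ ℓ′) b a d c

-- Edges of the counterexample as links of the Petersen graph

data Hop : Fin 16 → Fin 16 → Set where
  along : ∀ ℓ {x y} → Joins petersen (direct ℓ) x y → Hop (core x) (core y)
  into  : ∀ s {x y} → Joins petersen (subdivided s) x y → Hop (core x) (middle s)
  outof : ∀ s {x y} → Joins petersen (subdivided s) x y → Hop (middle s) (core y)

hop : ∀ e {u v} → Joins counterexample e u v → Hop u v
hop e j with splitAt 14 e | j
... | inj₁ ℓ | inj₁ refl = along ℓ (inj₁ refl)
... | inj₁ ℓ | inj₂ refl = along ℓ (inj₂ refl)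
... | inj₂ k | j′ with splitAt 6 k | j′
... | inj₁ s | inj₁ refl = into s (inj₁ refl)
... | inj₁ s | inj₂ refl = outof s (inj₂ refl)
... | inj₂ s | inj₁ refl = outof s (inj₁ refl)
... | inj₂ s | inj₂ refl = into s (inj₂ refl)

core-injective : ∀ {x y} → core x ≡ core y → x ≡ y
core-injective = ↑ˡ-injective 6 _ _

middle-injective : ∀ {s t} → middle s ≡ middle t → s ≡ t
middle-injective = ↑ʳ-injective 10 _ _

core≢middle : ∀ {x s} → core x ≢ middle s
core≢middle {x} {s} eq with () ← trans (sym (splitAt-↑ˡ 10 x 6)) (trans (cong (splitAt 10) eq) (splitAt-↑ʳ 10 6 s))

-- Of the two parallel links that make up a spoke, one is positive and one negative.
negative : Fin 15 → Maybe Bool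
negative = lookup (replicate 9 (just true) ++ replicate 5 nothing ++ just false ∷ [])

direct-negative : ∀ ℓ → negative (direct ℓ) ≢ just false
direct-negative = toWitness {a? = all? λ ℓ → ¬? (Maybe.≡-dec Bool._≟_ (negative (direct ℓ)) (just false))} _

subdivided-positive : ∀ s → negative (subdivided s) ≢ just true
subdivided-positive = toWitness {a? = all? λ s → ¬? (Maybe.≡-dec Bool._≟_ (negative (subdivided s)) (just true))} _

-- p is the sign of the link ℓ (true for negative) once its ends are re-signed by
-- b and c; a spoke allows both.
Usable : Bool → Fin 15 → Bool → Bool → Set
Usable p ℓ b c = ∀ {t} → negative ℓ ≡ just t → b xor c ≡ p xor t

usable-direct : ∀ {p} ℓ b c → b xor c ≡ not p → Usable p (direct ℓ) b c
usable-direct ℓ b c eq {false} τ = contradiction τ (direct-negative ℓ)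
usable-direct {true}  ℓ b c eq {true} τ = eq
usable-direct {false} ℓ b c eq {true} τ = eq

-- A path of two negative edges is a positive link, so its sign after re-signing is `b xor c`.
usable-subdivided : ∀ {p} s b c → b xor c ≡ p → Usable p (subdivided s) b c
usable-subdivided s b c eq {true} τ = contradiction τ (subdivided-positive s)
usable-subdivided {true}  s b c eq {false} τ = eq
usable-subdivided {false} s b c eq {false} τ = eq

-- A vertex of degree less than k is not a branch set of a complete minor on
-- k + 1 vertices.
module _ {n k} (α : Labelling n (suc k)) where

  private
    _∈ᵇ_ : Fin n → Fin (suc k) → Set
    u ∈ᵇ i = ∃[ b ] α u ≡ just (b , i)

  notAlone : ∀ {d} (R : Fin n → Fin n → Set) i v (nb : Fin d → Fin n) → d ℕ.< k →
    (∀ {w} → R v w → ∃[ h ] nb h ≡ w) →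
    (∀ {j} → i ≢ j → ∃[ u ] ∃[ w ] u ∈ᵇ i × w ∈ᵇ j × R u w) →
    ∃[ u ] u ∈ᵇ i × u ≢ v
  notAlone {d} R i v nb d<k complete touches = conclude (any? λ h → ¬? (source h ≟ v))
    where
    touch : ∀ h → ∃[ u ] ∃[ w ] u ∈ᵇ i × w ∈ᵇ punchIn i h × R u w
    touch h = touches (punchInᵢ≢i i h ∘ sym)

    source target : Fin k → Fin n
    source h = proj₁ (touch h)
    target h = proj₁ (proj₂ (touch h))

    module _ (none : ¬ (∃[ h ] source h ≢ v)) where

      found : ∀ h → ∃[ s ] nb s ≡ target h
      found h = complete (subst (λ u → R u (target h))
        (decidable-stable (source h ≟ v) (λ u≢v → none (h , u≢v)))
        (proj₂ (proj₂ (proj₂ (proj₂ (touch h))))))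

      slot-injective : ∀ h h′ → proj₁ (found h) ≡ proj₁ (found h′) → h ≡ h′
      slot-injective h h′ same =
        let _ , _ , _ , (_ , p) , _ = touch h
            _ , _ , _ , (_ , q) , _ = touch h′
            w≡w′ = trans (sym (proj₂ (found h))) (trans (cong nb same) (proj₂ (found h′)))
        in punchIn-injective i h h′
             (,-injectiveʳ (just-injective (trans (sym p) (trans (cong α w≡w′) q))))

    conclude : Dec (∃[ h ] source h ≢ v) → ∃[ u ] u ∈ᵇ i × u ≢ v
    conclude (yes (h , u≢v)) = source h , proj₁ (proj₂ (proj₂ (touch h))) , u≢v
    conclude (no none)       =
      let h , h′ , h<h′ , same = pigeonhole d<k (proj₁ ∘ found none)
      in contradiction (slot-injective none h h′ same) (<⇒≢ h<h′)

-- From branch sets to perfect matchings of the Petersen graph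

injective⇒surjective : ∀ {n} (f : Fin n → Fin n) → (∀ {i j} → f i ≡ f j → i ≡ j) → ∀ z → ∃[ i ] f i ≡ z
injective⇒surjective {suc n} f inj z with any? (λ i → f i ≟ z)
... | yes found = found
... | no  none  = contradiction
  (λ {i} {j} eq → inj (punchOut-injective {i = z} (λ p → none (i , sym p)) (λ p → none (j , sym p)) eq))
  (<⇒notInjective ℕ.≤-refl)

branch-unique : ∀ {n k} (α : Labelling n k) {u b c i j} →
                α u ≡ just (b , i) → α u ≡ just (c , j) → (b , i) ≡ (c , j)
branch-unique α p q = just-injective (trans (sym p) q)

Link : Labelling 10 5 → Bool → Fin 10 → Fin 10 → Fin 5 → Fin 5 → Set
Link φ p x y i j = ∃[ ℓ ] ∃[ b ] ∃[ c ] Joins petersen ℓ x y ×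
  φ x ≡ just (b , i) × φ y ≡ just (c , j) × Usable p ℓ b c

-- The matching condition at a vertex, solved for the spoke (index 2) so that `BadMatching` can
-- eliminate it.
exactlyOne : (f : Fin 3 → Bool) → ∃[ k ] f k ≡ true →
             (∀ k k′ → f k ≡ true → f k′ ≡ true → k ≡ k′) →
             f zero ∨ f (# 1) ≡ not (f (# 2)) × f zero ∧ f (# 1) ≡ false
exactlyOne f (k , fk) unique with f zero in p | f (# 1) in q | f (# 2) in r
... | true  | true  | _     with () ← unique _ _ p q
... | true  | false | true  with () ← unique _ _ p r
... | false | true  | true  with () ← unique _ _ q r
... | true  | false | false = refl , refl
... | false | true  | false = refl , refl
... | false | false | true  = refl , refl
exactlyOne f (zero , fk)           unique | false | false | false with () ← trans (sym p) fk
exactlyOne f (suc zero , fk)       unique | false | false | false with () ← trans (sym q) fk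
exactlyOne f (suc (suc zero) , fk) unique | false | false | false with () ← trans (sym r) fk

pentagonLink : Fin 10 → Fin 15
pentagonLink = lookup (# 0 ∷ # 1 ∷ # 2 ∷ # 3 ∷ # 4 ∷ # 5 ∷ # 6 ∷ # 7 ∷ # 8 ∷ # 14 ∷ [])

rim : Fin 10 → Fin 2 → Fin 10
rim v = lookup (lookup
  ( (# 4 ∷ # 0 ∷ []) ∷ (# 0 ∷ # 1 ∷ []) ∷ (# 1 ∷ # 2 ∷ []) ∷ (# 2 ∷ # 3 ∷ []) ∷ (# 3 ∷ # 4 ∷ [])
  ∷ (# 8 ∷ # 5 ∷ []) ∷ (# 9 ∷ # 6 ∷ []) ∷ (# 5 ∷ # 7 ∷ []) ∷ (# 6 ∷ # 8 ∷ []) ∷ (# 7 ∷ # 9 ∷ []) ∷ []) v)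

rim-joins : ∀ v h → Joins petersen (pentagonLink (rim v h)) v (neighbour v (Fin.inject₁ h))
rim-joins = toWitness {a? = all? λ v → all? λ h →
  joins? petersen (pentagonLink (rim v h)) v (neighbour v (Fin.inject₁ h))} _

neighbour-distinct : ∀ v k → v ≢ neighbour v k × (∀ k′ → neighbour v k ≡ neighbour v k′ → k ≡ k′)
neighbour-distinct = toWitness {a? = all? λ v → all? λ k →
  ¬? (v ≟ neighbour v k) ×-dec all? λ k′ → neighbour v k ≟ neighbour v k′ →-dec k ≟ k′} _

outer inner : Fin 5 → Fin 10
outer i = i ↑ˡ 5
inner i = 5 ↑ʳ i

spoke-neighbour : ∀ i → neighbour (outer i) (# 2) ≡ inner i × neighbour (inner i) (# 2) ≡ outer i
spoke-neighbour = toWitness {a? = all? λ i → neighbour (outer i) (# 2) ≟ inner i ×-dec neighbour (inner i) (# 2) ≟ outer i} _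

-- The pentagon edges S of a perfect matching, with parities that do not fit:
-- such a matching uses equally many edges of the two pentagons.
BadMatching : Subset 10 → Set
BadMatching S =
  (∀ i → lookup S (rim (outer i) zero) ∨ lookup S (rim (outer i) (# 1)) ≡
         lookup S (rim (inner i) zero) ∨ lookup S (rim (inner i) (# 1))) ×
  (∀ v → lookup S (rim v zero) ∧ lookup S (rim v (# 1)) ≡ false) ×
  s (# 0) xor (s (# 1) xor (s (# 2) xor (s (# 3) xor s (# 4)))) ≡ false ×
  s (# 5) xor (s (# 6) xor (s (# 7) xor (s (# 8) xor not (s (# 9))))) ≡ false
  where s = lookup S

-- With the spokes eliminated, only the 1024 sets of pentagon edges remain, and evaluation checks
-- them all.
noBadMatching : ¬ ∃ BadMatching
noBadMatching = toWitnessFalse {a? = anySubset? λ S →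
  all? (λ i → _ Bool.≟ _) ×-dec all? (λ v → _ Bool.≟ _) ×-dec _ Bool.≟ _ ×-dec _ Bool.≟ _} _

-- The trace of an odd K₅ model on the Petersen graph: links between different branch sets are
-- negative (`true`), those inside one are positive (`false`).
module Matching (φ : Labelling 10 5)
  (crossing : ∀ {i j} → i ≢ j → ∃[ x ] ∃[ y ] Link φ true x y i j)
  (mate     : ∀ {v i b} → φ v ≡ just (b , i) → ∃[ w ] Link φ false v w i i)
  where

  pair : ∀ i → ∃[ x ] ∃[ y ] Link φ false x y i i
  -- A link to any other branch set shows that this one is not empty.
  pair i with crossing {i} (punchInᵢ≢i i zero ∘ sym)
  ... | x , _ , _ , _ , _ , _ , p , _ = x , mate p

  -- Every branch set has two vertices, which makes ten in all.
  member : Fin 5 → Fin 2 → Fin 10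
  member i zero       = proj₁ (pair i)
  member i (suc zero) = proj₁ (proj₂ (pair i))

  member-branch : ∀ i h → ∃[ b ] φ (member i h) ≡ just (b , i)
  member-branch i zero       = let _ , _ , _ , b , _ , _ , p , _ = pair i in b , p
  member-branch i (suc zero) = let _ , _ , _ , _ , c , _ , _ , q , _ = pair i in c , q

  members-distinct : ∀ i → member i zero ≢ member i (# 1)
  members-distinct i = let _ , _ , ℓ , _ , _ , j , _ = pair i in petersen-loopless ℓ j

  member-injective : ∀ i h i′ h′ → member i h ≡ member i′ h′ → (i , h) ≡ (i′ , h′)
  member-injective i h i′ h′ eq with ,-injectiveʳ (branch-unique φ (proj₂ (member-branch i h))
                                       (trans (cong φ eq) (proj₂ (member-branch i′ h′))))
  member-injective i zero       i zero       eq | refl = refl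
  member-injective i (suc zero) i (suc zero) eq | refl = refl
  member-injective i zero       i (suc zero) eq | refl = contradiction eq (members-distinct i)
  member-injective i (suc zero) i zero       eq | refl = contradiction (sym eq) (members-distinct i)

  abstract
    member-surjective : ∀ z → ∃[ i ] ∃[ h ] member i h ≡ z
    member-surjective z =
      let k , eq = injective⇒surjective (λ k → let i , h = remQuot {5} 2 k in member i h) injective z
          i , h  = remQuot {5} 2 k
      in i , h , eq
      where
      injective : ∀ {k k′} → let i , h = remQuot {5} 2 k ; i′ , h′ = remQuot {5} 2 k′ in
                  member i h ≡ member i′ h′ → k ≡ k′
      injective {k} {k′} eq = trans (sym (combine-remQuot {5} 2 k))
        (trans (cong (λ (i , h) → Fin.combine i h) (let i , h = remQuot {5} 2 k ; i′ , h′ = remQuot {5} 2 k′ in member-injective i h i′ h′ eq)) (combine-remQuot {5} 2 k′))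

  branch : Fin 10 → Fin 5
  branch z = proj₁ (member-surjective z)

  slot : Fin 10 → Fin 2
  slot z = proj₁ (proj₂ (member-surjective z))

  member-slot : ∀ z → member (branch z) (slot z) ≡ z
  member-slot z = proj₂ (proj₂ (member-surjective z))

  bit : Fin 10 → Bool
  bit z = proj₁ (member-branch (branch z) (slot z))

  at : ∀ z → φ z ≡ just (bit z , branch z)
  at z = trans (cong φ (sym (member-slot z))) (proj₂ (member-branch (branch z) (slot z)))

  -- A `Link` between vertices that are known to be labelled, with `bit` in place of the existential
  -- bits.
  Bond : Bool → Fin 10 → Fin 10 → Set
  Bond p y z = ∃[ ℓ ] Joins petersen ℓ y z × Usable p ℓ (bit y) (bit z)

  Bond-sym : ∀ {p} y z → Bond p y z → Bond p z y
  Bond-sym y z (ℓ , j , usable) =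
    ℓ , Sum.swap j , λ τ → trans (xor-comm (bit z) (bit y)) (usable τ)

  bond : ∀ p y z {i j} → Link φ p y z i j → branch y ≡ i × branch z ≡ j × Bond p y z
  bond _ y z (ℓ , b , c , j , p , q , usable)
    with refl ← branch-unique φ (at y) p | refl ← branch-unique φ (at z) q = refl , refl , ℓ , j , usable

  pair-bond : ∀ i → Bond false (member i zero) (member i (# 1))
  pair-bond i = let x , y , l = pair i in proj₂ (proj₂ (bond false x y l))

  slot-injective : ∀ y z → branch y ≡ branch z → slot y ≡ slot z → y ≡ z
  slot-injective y z p q = trans (sym (member-slot y)) (trans (cong₂ member p q) (member-slot z))

  -- Distinct vertices of a branch set occupy its two slots, and `pair` bonds these.
  together : ∀ {y z} → branch y ≡ branch z → y ≢ z → Bond false y z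
  together {y} {z} eq y≢z = go (slot y) (slot z) refl refl
    where
    go : ∀ a b → slot y ≡ a → slot z ≡ b → Bond false y z
    go zero       zero       p q = contradiction (slot-injective y z eq (trans p (sym q))) y≢z
    go (suc zero) (suc zero) p q = contradiction (slot-injective y z eq (trans p (sym q))) y≢z
    go zero       (suc zero) p q = subst₂ (Bond false)
      (trans (cong (member (branch y)) (sym p)) (member-slot y))
      (trans (cong₂ member eq (sym q)) (member-slot z))
      (pair-bond (branch y))
    go (suc zero) zero       p q = Bond-sym {false} z y (subst₂ (Bond false)
      (trans (cong (member (branch z)) (sym q)) (member-slot z))
      (trans (cong₂ member (sym eq) (sym p)) (member-slot y))
      (pair-bond (branch z)))

  noThree : ∀ x y z → branch x ≡ branch y → branch x ≡ branch z → x ≢ y → x ≢ z → ¬ y ≢ z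
  noThree x y z p q x≢y x≢z y≢z = distinct (x≢y ∘ slot-injective x y p) (x≢z ∘ slot-injective x z q)
    (y≢z ∘ slot-injective y z (trans (sym p) q))
    where
    distinct : ∀ {a b c : Fin 2} → a ≢ b → a ≢ c → ¬ b ≢ c
    distinct {zero}     {zero}                p _ _ = p refl
    distinct {zero}     {suc zero} {zero}     _ q _ = q refl
    distinct {zero}     {suc zero} {suc zero} _ _ r = r refl
    distinct {suc zero} {suc zero}            p _ _ = p refl
    distinct {suc zero} {zero}     {suc zero} _ q _ = q refl
    distinct {suc zero} {zero}     {zero}     _ _ r = r refl

  near : ∀ {y z} → branch z ≡ branch y → Near y z
  near {y} {z} eq with y ≟ z
  ... | yes y≡z = inj₁ y≡z
  ... | no  y≢z = let ℓ , j , _ = together (sym eq) y≢z in inj₂ (Joins⇒Neighbour ℓ j)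

  same : Fin 10 → Fin 10 → Bool
  same y z = does (branch y ≟ branch z)

  -- By the girth, the link ℓ is the only one between its two branch sets.
  resigned : ∀ ℓ {y z t} → Joins petersen ℓ y z → negative ℓ ≡ just t →
             bit y xor bit z ≡ not (same y z) xor t
  resigned ℓ {y} {z} j τ with branch y ≟ branch z
  ... | yes eq =
    let ℓ′ , j′ , usable = together eq (petersen-loopless ℓ j)
        ℓ′≡ℓ = girth ℓ ℓ′ j j′ (petersen-loopless ℓ j) (petersen-loopless ℓ j ∘ sym) (inj₁ refl) (inj₁ refl)
    in usable (trans (cong negative ℓ′≡ℓ) τ)
  ... | no y≉z with crossing y≉z
  ... | y′ , z′ , l with bond true y′ z′ l
  ... | y′≈y , z′≈z , ℓ′ , j′ , usable
    -- Each end of `ℓ′` is the corresponding end of `ℓ` or its mate, hence near it.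
    with girth ℓ ℓ′ j j′ (λ { refl → y≉z (sym y′≈y) }) (λ { refl → y≉z z′≈z }) (near y′≈y) (near z′≈z)
  ... | refl with Joins-cases petersen ℓ j j′
  ... | inj₁ (refl , refl) = usable τ
  ... | inj₂ (refl , refl) = contradiction z′≈z y≉z

  same-sym : ∀ y z → same y z ≡ same z y
  same-sym y z with branch y ≟ branch z
  ... | yes eq = sym (dec-true (branch z ≟ branch y) (sym eq))
  ... | no neq = sym (dec-false (branch z ≟ branch y) (neq ∘ sym))

  same⇒≡ : ∀ y z → same y z ≡ true → branch y ≡ branch z
  same⇒≡ y z eq with branch y ≟ branch z
  ... | yes p = p

  -- `mate` provides a neighbour in the branch set of `v`, and `noThree` excludes a second one.
  matched : ∀ v → same v (neighbour v zero) ∨ same v (neighbour v (# 1)) ≡ not (same v (neighbour v (# 2))) ×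
                  same v (neighbour v zero) ∧ same v (neighbour v (# 1)) ≡ false
  matched v = exactlyOne (λ k → same v (neighbour v k)) (exists (mate (at v))) unique
    where
    exists : ∃[ w ] Link φ false v w (branch v) (branch v) → ∃[ k ] same v (neighbour v k) ≡ true
    exists (w , l) with bond false v w l
    ... | _ , w≈v , ℓ , j , _ with Joins⇒Neighbour ℓ j
    ... | k , refl = k , dec-true (branch v ≟ branch w) (sym w≈v)

    unique : ∀ k k′ → same v (neighbour v k) ≡ true → same v (neighbour v k′) ≡ true → k ≡ k′
    unique k k′ p q = decidable-stable (k ≟ k′) λ k≢k′ →
      noThree v (neighbour v k) (neighbour v k′) (same⇒≡ v (neighbour v k) p) (same⇒≡ v (neighbour v k′) q) (proj₁ (neighbour-distinct v k)) (proj₁ (neighbour-distinct v k′))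
        (k≢k′ ∘ proj₂ (neighbour-distinct v k) k′)

  inside-branch : Fin 10 → Bool
  inside-branch k = let x , y = ends petersen (pentagonLink k) in same x y

  edgeSet : Subset 10
  edgeSet = tabulate inside-branch

  rim-same : ∀ v h → lookup edgeSet (rim v h) ≡ same v (neighbour v (Fin.inject₁ h))
  rim-same v h = trans (lookup∘tabulate inside-branch (rim v h)) (oriented (pentagonLink (rim v h)) (rim-joins v h))
    where
    oriented : ∀ ℓ {y z} → Joins petersen ℓ y z → let x , w = ends petersen ℓ in same x w ≡ same y z
    oriented ℓ (inj₁ refl) = refl
    oriented ℓ (inj₂ refl) = let x , w = ends petersen ℓ in same-sym x w

  impossible : ⊥
  impossible = noBadMatching (edgeSet , balanced , disjoint , outerSum , innerSum)
    where
    rims : ∀ (_∙_ : Bool → Bool → Bool) v →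
      lookup edgeSet (rim v zero) ∙ lookup edgeSet (rim v (# 1)) ≡ same v (neighbour v zero) ∙ same v (neighbour v (# 1))
    rims _∙_ v = cong₂ _∙_ (rim-same v zero) (rim-same v (# 1))

    spoke : ∀ i → same (outer i) (neighbour (outer i) (# 2)) ≡ same (inner i) (neighbour (inner i) (# 2))
    spoke i = trans (cong (same (outer i)) (proj₁ (spoke-neighbour i)))
      (trans (same-sym (outer i) (inner i)) (sym (cong (same (inner i)) (proj₂ (spoke-neighbour i)))))

    -- Both sides say that spoke `i` is not in the matching.
    balanced : ∀ i → lookup edgeSet (rim (outer i) zero) ∨ lookup edgeSet (rim (outer i) (# 1)) ≡
                     lookup edgeSet (rim (inner i) zero) ∨ lookup edgeSet (rim (inner i) (# 1))
    balanced i = begin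
      _ ≡⟨ rims _∨_ (outer i) ⟩
      _ ≡⟨ proj₁ (matched (outer i)) ⟩
      _ ≡⟨ cong not (spoke i) ⟩
      _ ≡⟨ proj₁ (matched (inner i)) ⟨
      _ ≡⟨ rims _∨_ (inner i) ⟨
      _ ∎
      where open ≡-Reasoning

    disjoint : ∀ v → lookup edgeSet (rim v zero) ∧ lookup edgeSet (rim v (# 1)) ≡ false
    disjoint v = trans (rims _∧_ v) (proj₂ (matched v))

    -- The sign `true` of a negative link cancels the negation in `resigned`.
    side : ∀ {y z} ℓ → Joins petersen ℓ y z → negative ℓ ≡ just true → same y z ≡ bit y xor bit z
    side {y} {z} ℓ j τ = trans (flip (same y z)) (sym (resigned ℓ j τ))
      where
      flip : ∀ s → s ≡ not s xor true
      flip true  = refl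
      flip false = refl

    outerSum : _
    outerSum = trans
      (cong₂ _xor_ (side (# 0) (inj₁ refl) refl) (cong₂ _xor_ (side (# 1) (inj₁ refl) refl)
        (cong₂ _xor_ (side (# 2) (inj₁ refl) refl) (cong₂ _xor_ (side (# 3) (inj₁ refl) refl)
          (side (# 4) (inj₁ refl) refl)))))
      -- Around a pentagon every bit occurs twice.
      (solve 5 (λ a b c d e →
        (a :+ b) :+ ((b :+ c) :+ ((c :+ d) :+ ((d :+ e) :+ (e :+ a)))) := con false) refl
        (bit (# 0)) (bit (# 1)) (bit (# 2)) (bit (# 3)) (bit (# 4)))

    innerSum : _
    innerSum = trans
      (cong₂ _xor_ (side (# 5) (inj₁ refl) refl) (cong₂ _xor_ (side (# 6) (inj₁ refl) refl)
        (cong₂ _xor_ (side (# 7) (inj₁ refl) refl) (cong₂ _xor_ (side (# 8) (inj₁ refl) refl)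
          -- The subdivided edge is the one positive link of its pentagon, so here the negation
          -- stays.
          (trans (sym (xor-identityʳ (not (same (# 9) (# 6))))) (sym (resigned (# 14) (inj₁ refl) refl)))))))
      (solve 5 (λ a b c d e →
        (a :+ c) :+ ((b :+ d) :+ ((c :+ e) :+ ((d :+ a) :+ (e :+ b)))) := con false) refl
        (bit (# 5)) (bit (# 6)) (bit (# 7)) (bit (# 8)) (bit (# 9)))

-- No odd K₅ minor

xor-not : ∀ b → b xor not b ≡ true
xor-not true  = refl
xor-not false = refl

abstract
  K₅-complete : ∀ i j → i ≢ j → ∃[ h ] Joins (K 5) h i j
  K₅-complete = toWitness {a? = all? λ i → all? λ j → ¬? (i ≟ j) →-dec any? λ h → joins? (K 5) h i j} _

sign-odd : ∀ {n m} {G : Graph n m} e → sign (odd G) e ≡ true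
sign-odd e = lookup-replicate e true

module NoModel (M : Model (odd counterexample) (odd (K 5))) where

  α : Labelling 16 5
  α = Model.label M

  -- Crossing edges are negative before and after re-signing, so their ends carry the same bit.
  touching : ∀ {i j} → i ≢ j → ∃[ u ] ∃[ w ] ∃[ b ]
    Hop u w × α u ≡ just (b , i) × α w ≡ just (b , j)
  touching i≢j with K₅-complete _ _ i≢j
  ... | h , jh with Model.crossing M {h} jh
  ... | e , u , v , b , c , j , p , q , s =
    u , v , b , hop e j , p , subst (λ c → α v ≡ just (c , _)) (sym (equal b c both-negative)) q
    where
    both-negative : true ≡ (b xor c) xor true
    both-negative = trans (sym (sign-odd {G = K 5} h)) (trans s (cong ((b xor c) xor_) (sign-odd {G = counterexample} e)))

    equal : ∀ b c → true ≡ (b xor c) xor true → b ≡ c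
    equal true  true  _ = refl
    equal false false _ = refl

  -- Inside a branch set a negative edge has become positive, so the bit flips along it.
  step : ∀ {i u v b} → Inner (odd counterexample) α i u v → α u ≡ just (b , i) →
         Hop u v × α v ≡ just (not b , i)
  step {b = b} (e , b′ , c , j , p , q , s) p′ with refl ← ,-injectiveˡ (branch-unique α p p′) =
    hop e j , subst (λ c → α _ ≡ just (c , _)) (opposite b′ c (trans (sym (sign-odd {G = counterexample} e)) s)) q
    where
    opposite : ∀ b c → true ≡ b xor c → c ≡ not b
    opposite true  false _ = refl
    opposite false true  _ = refl

  -- A middle vertex has degree two, so by `notAlone` it is not a whole branch set; the path to
  -- another vertex of its branch set starts with a step to a core vertex.
  middle-branch : ∀ s {i b} → α (middle s) ≡ just (b , i) →
                  ∃[ x ] ∃[ y ] Joins petersen (subdivided s) x y × α (core y) ≡ just (not b , i)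
  middle-branch s {i} {b} p =
    let u , (_ , q) , u≢s = notAlone α Hop i (middle s) (lookup neighbours)
          (ℕ.s≤s (ℕ.s≤s (ℕ.s≤s ℕ.z≤n))) (λ h → at-ends h refl)
          (λ i≢j → let u , w , b , h , p , q = touching i≢j in u , w , (b , p) , (b , q) , h)
    in first u≢s (Model.connects M p q) refl p
    where
    neighbours : Vec (Fin 16) 2
    neighbours = let x , y = ends petersen (subdivided s) in core x ∷ core y ∷ []

    at-ends : ∀ {m w} → Hop m w → m ≡ middle s → ∃[ h ] lookup neighbours h ≡ w
    at-ends (along _ _) eq = contradiction eq core≢middle
    at-ends (into _ _)  eq = contradiction eq core≢middle
    at-ends (outof t (inj₁ q)) eq with refl ← middle-injective {t} {s} eq = # 1 , cong (core ∘ proj₂) q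
    at-ends (outof t (inj₂ q)) eq with refl ← middle-injective {t} {s} eq = # 0 , cong (core ∘ proj₁) q

    first : ∀ {m u} → u ≢ middle s → Star (Inner (odd counterexample) α i) m u → m ≡ middle s →
            α m ≡ just (b , i) →
            ∃[ x ] ∃[ y ] Joins petersen (subdivided s) x y × α (core y) ≡ just (not b , i)
    first u≢s ε eq _ = contradiction eq u≢s
    first u≢s (st ◅ _) eq p with step st p
    ... | along _ _ , _ = contradiction eq core≢middle
    ... | into _ _ , _  = contradiction eq core≢middle
    ... | outof t j , r with refl ← middle-injective {t} {s} eq = _ , _ , j , r

  -- The branch set of the middle vertex contains an end of the path. That end is not `x`, which
  -- lies in another branch set, so the whole path links the two.
  linked-via : ∀ s {i j x y b} → i ≢ j → Joins petersen (subdivided s) x y →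
               α (core x) ≡ just (b , i) → α (middle s) ≡ just (b , j) →
               ∃[ z ] Joins petersen (subdivided s) x z × α (core z) ≡ just (not b , j)
  linked-via s i≢j jxy p q with middle-branch s q
  ... | _ , z , j , r with Joins-cases petersen (subdivided s) jxy j
  ... | inj₁ (refl , _) = z , j , r
  ... | inj₂ (refl , _) = contradiction (,-injectiveʳ (branch-unique α p r)) i≢j

  linked : ∀ {i j} → i ≢ j → ∃[ x ] ∃[ y ] Link (α ∘ core) true x y i j
  linked i≢j with touching i≢j
  ... | _ , _ , b , along ℓ j , p , q = _ , _ , direct ℓ , b , b , j , p , q , usable-direct ℓ b b (xor-same b)
  ... | _ , _ , b , into s j , p , q =
    let z , j′ , r = linked-via s i≢j j p q in
    _ , z , subdivided s , b , not b , j′ , p , r , usable-subdivided s b (not b) (xor-not b)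
  ... | _ , _ , b , outof s j , p , q =
    let z , j′ , r = linked-via s (i≢j ∘ sym) (Sum.swap j) q p in
    z , _ , subdivided s , not b , b , Sum.swap j′ , r , q ,
    usable-subdivided s (not b) b (trans (xor-comm (not b) b) (xor-not b))

  -- The first vertex of the Petersen graph other than v on a path inside the
  -- branch set of v is a mate of v.
  module _ {v u : Fin 10} {i b} (p : α (core v) ≡ just (b , i)) (u≢v : u ≢ v) where

    fromCore   : ∀ {a} → Star (Inner (odd counterexample) α i) a (core u) → a ≡ core v →
                 ∃[ w ] Link (α ∘ core) false v w i i
    fromMiddle : ∀ {a s y} → Star (Inner (odd counterexample) α i) a (core u) → a ≡ middle s →
                 Joins petersen (subdivided s) v y → α (middle s) ≡ just (not b , i) →
                 ∃[ w ] Link (α ∘ core) false v w i i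

    fromCore ε eq = contradiction (core-injective eq) u≢v
    fromCore (st ◅ sts) eq with step st (trans (cong α eq) p)
    ... | along ℓ j , q with refl ← core-injective eq =
      _ , direct ℓ , b , not b , j , p , q , usable-direct ℓ b (not b) (xor-not b)
    ... | into s j , q with refl ← core-injective eq = fromMiddle sts refl j q
    ... | outof s j , q = contradiction (sym eq) core≢middle

    fromMiddle ε eq j q = contradiction eq core≢middle
    fromMiddle (st ◅ sts) eq j q with step st (trans (cong α eq) q)
    ... | along _ _ , _ = contradiction eq core≢middle
    ... | into _ _ , _  = contradiction eq core≢middle
    ... | outof t j′ , r with refl ← middle-injective {t} eq with Joins-cases petersen (subdivided t) j j′
    ... | inj₁ (refl , refl) = _ , subdivided t , b , not (not b) , j , p , r ,
            usable-subdivided t b (not (not b)) (trans (cong (b xor_) (not-involutive b)) (xor-same b))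
    -- The path has turned back to `v`; the search goes on with the rest of it.
    ... | inj₂ (refl , _)    = fromCore sts refl

  -- The Petersen graph has degree three, so by `notAlone` the branch set contains a second core
  -- vertex, and the path towards it has to leave `v`.
  mate : ∀ {v i b} → α (core v) ≡ just (b , i) → ∃[ w ] Link (α ∘ core) false v w i i
  mate {v} {i} p =
    let u , (_ , q) , u≢v = notAlone (α ∘ core) (λ u w → ∃[ ℓ ] Joins petersen ℓ u w) i v (neighbour v)
          (ℕ.s≤s (ℕ.s≤s (ℕ.s≤s (ℕ.s≤s ℕ.z≤n)))) (λ (ℓ , j) → Joins⇒Neighbour ℓ j)
          (λ i≢j → let x , y , ℓ , b , c , j , p , q , _ = linked i≢j in x , y , (b , p) , (c , q) , ℓ , j)
    in fromCore p u≢v (Model.connects M p q) refl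

  noModel : ⊥
  noModel = Matching.impossible (α ∘ core) linked mate

theorem1p5 : ∃[ n ] ∃[ m ] Σ[ G ∈ Graph n m ]
    (G is 2 -connected) × Eulerian G × Loopless G × OddMinorFree (K 5) G ×
    2 ∣ m × ¬ EvenCycleDecomposable G
theorem1p5 =
  16 , 26 , counterexample , counterexample-2-connected , counterexample-eulerian , counterexample-loopless ,
  (λ minor → NoModel.noModel (HasMinor⇒Model minor)) , divides 13 refl , counterexample-¬decomposable
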